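{- In the category of hypercoherences and linear maps, for every hypercoherence $A$: (i) $\mathrm{flag}$ is self-dual: $(\mathrm{flag}\,A)^{\perp}=\mathrm{flag}(A^{\perp})$; (ii) $A$ is a retract of $\mathrm{flag}\,A$, i.e. there are linear maps $f:A\to\mathrm{flag}\,A$ and $t:\mathrm{flag}\,A\to A$ with $t\circ f=\mathrm{Id}_A$; (iii) $\mathrm{flag}\,A$ is isomorphic to $(\mathrm{flag}\,A)\triangleleft(\mathrm{flag}\,A)$.
   Context: $\#M$ denotes the cardinality of a set $M$, and $\mathcal{P}^*_{\mathrm{fin}}(M)$ the set of finite nonempty subsets of $M$. A hypercoherence $X$ consists of a set $|X|$ (its web) and a set $\Gamma(X)\subset\mathcal{P}^*_{\mathrm{fin}}(|X|)$ (atomic coherence) containing all singletons. Strict atomic coherence $\Gamma^*(X)$ is $\Gamma(X)$ minus all singletons; a hypercoherence is determined by its web and $\Gamma^*(X)$. Negation: $X^{\perp}=(|X|,\ \mathcal{P}^*_{\mathrm{fin}}(|X|)\setminus\Gamma^*(X))$. Linear implication: $X\multimap Y$ has web $|X|\times|Y|$, and a finite nonempty $w\subset|X|\times|Y|$, with projections $w_1$ on $|X|$ and $w_2$ on $|Y|$, is in $\Gamma(X\multimap Y)$ iff: (if $w_1\in\Gamma(X)$ then $w_2\in\Gamma(Y)$) and (if $w_1\in\Gamma(X)$ and $\#w_1\ge2$ then $w_2\in\Gamma(Y)$ and $\#w_2\geq 2$). A linear map from $X$ to $Y$ is a subset of $|X|\times|Y|$ all of whose finite nonempty subsets belong to $\Gamma(X\multimap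 Y)$; linear maps compose as relations, and the identity is the diagonal. Before: $X\triangleleft Y$ has web $|X|\times|Y|$, and a finite nonempty $w\subset |X|\times|Y|$, with projections $\pi_1(w)$ on $|X|$ and $\pi_2(w)$ on $|Y|$, is in $\Gamma^*(X\triangleleft Y)$ iff $\pi_1(w)\in\Gamma^*(X)$ or [$\#\pi_1(w)=1$ and $\pi_2(w)\in\Gamma^*(Y)$]. Let $2^{\omega}$ be the set of infinite words on $\{0,1\}$, with the product topology (Cantor space) and the lexicographic total order: $w_1<w_2$ iff there are a finite word $m$ and infinite words $w_1',w_2'$ with $w_1=m0w_1'$ and $w_2=m1w_2'$. Flag: $\mathrm{flag}\,X$ is the hypercoherence whose web is the set of continuous functions from $2^\omega$ to $|X|$ (with the discrete topology on $|X|$), and $\{f_1,\dots,f_k\}\in\Gamma^*(\mathrm{flag}\,X)$ iff there exists $u\in2^\omega$ such that $\{f_1(u),\dots,f_k(u)\}\in\Gamma^*(X)$ and $\#\{f_1(u'),\dots,f_k(u')\}=1$ for all $u'<u$. -}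

module Defs where

open import Level using (Level; suc)
open import Data.Bool.Base using (Bool; true; false)
open import Data.List.Base using (List; []; _∷_)
import Data.List.Base as List
open import Data.List.Membership.Setoid.Properties using (∈-map⁺; ∈-map⁻; ∈-resp-≈)
import Data.List.Membership.Setoid as Membership
import Data.List.Relation.Binary.Subset.Setoid as Subset
import Data.List.Relation.Unary.All as ListAll
open import Data.List.Relation.Unary.Any using (here; there)
open import Data.List.NonEmpty.Base using (List⁺; _∷_; [_]; map; toList)
open import Data.List.NonEmpty.Relation.Unary.All using (All; _∷_)
open import Data.Nat.Base using (ℕ; zero; _<_) renaming (suc to 1+_)
open import Data.Product.Base using (Σ; ∃; ∃₂; _×_; _,_; proj₁; proj₂; uncurry)
open import Data.Product.Relation.Binary.Pointwise.NonDependent using (×-setoid)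
open import Data.Sum.Base using (_⊎_; inj₁; inj₂)
open import Function.Base using (_∘_)
open import Function.Bundles using (_⇔_; mk⇔)
open import Relation.Binary.Bundles using (Setoid)
open import Relation.Binary.Core using (_Preserves_⟶_)
open import Relation.Binary.Definitions using (_Respects_)
open import Relation.Binary.PropositionalEquality using (_≡_; refl; cong; subst; _≗_)
open import Relation.Nullary.Negation using (¬_; contradiction)
open import Relation.Unary using (Pred)

private
  variable
    a : Level

-- Sets are setoids.  A finite nonempty subset of S is represented by a
-- nonempty list enumerating it (repetitions allowed); two lists represent the
-- same subset when they have the same elements.

module FiniteSubsets (S : Setoid a a) where
  open Setoid S renaming (Carrier to M)
  open Membership S using (_∈_)
  open Subset S using (_⊆_)

  infix 4 _≋_

  _≋_ : List⁺ M → List⁺ M → Set a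
  w ≋ v = toList w ⊆ toList v × toList v ⊆ toList w

  -- #w = 1
  IsSingleton : List⁺ M → Set a
  IsSingleton w = ∃ λ x → w ≋ [ x ]

  -- #w ≥ 2
  AtLeastTwo : List⁺ M → Set a
  AtLeastTwo w = ∃₂ λ x y → x ∈ toList w × y ∈ toList w × ¬ x ≈ y

  ≋-sym : ∀ {w v} → w ≋ v → v ≋ w
  ≋-sym (p , q) = q , p

  IsSingleton-resp : IsSingleton Respects _≋_
  IsSingleton-resp (p , q) (x , r , s) = x , (λ m → r (q m)) , λ m → p (s m)

  AtLeastTwo-resp : AtLeastTwo Respects _≋_
  AtLeastTwo-resp (p , _) (x , y , x∈w , y∈w , x≉y) = x , y , p x∈w , p y∈w , x≉y

  [x]-isSingleton : ∀ x → IsSingleton [ x ]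
  [x]-isSingleton x = x , (λ m → m) , λ m → m

  ¬AtLeastTwo-[x] : ∀ {w} → IsSingleton w → ¬ AtLeastTwo w
  ¬AtLeastTwo-[x] (z , p , _) (x , y , x∈w , y∈w , x≉y) with p x∈w | p y∈w
  ... | here x≈z | here y≈z = x≉y (trans x≈z (Setoid.sym S y≈z))

module _ {S T : Setoid a a} where
  private
    module S = FiniteSubsets S
    module T = FiniteSubsets T

  map-≋ : ∀ {f} → f Preserves Setoid._≈_ S ⟶ Setoid._≈_ T →
          ∀ {w v} → w S.≋ v → map f w T.≋ map f v
  map-≋ {f} pres (p , q) = half p , half q
    where
    half : ∀ {xs ys} → Subset._⊆_ S xs ys → Subset._⊆_ T (List.map f xs) (List.map f ys)
    half xs⊆ys m with ∈-map⁻ S T m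
    ... | _ , x∈xs , v≈fx = ∈-resp-≈ T (Setoid.sym T v≈fx) (∈-map⁺ S T pres (xs⊆ys x∈xs))

  map-isSingleton : ∀ {f} → f Preserves Setoid._≈_ S ⟶ Setoid._≈_ T →
                    ∀ {w} → S.IsSingleton w → T.IsSingleton (map f w)
  map-isSingleton {f} pres {w} (x , e) = f x , map-≋ pres {w} {[ x ]} e

record Hypercoherence (a : Level) : Set (suc a) where
  field
    web : Setoid a a

  open Setoid web public using () renaming (Carrier to ∣_∣)
  open FiniteSubsets web

  field
    Γ           : List⁺ ∣_∣ → Set a
    Γ-resp      : Γ Respects _≋_
    Γ-singleton : ∀ x → Γ [ x ]

  Γ* : List⁺ ∣_∣ → Set a
  Γ* w = Γ w × ¬ IsSingleton w

  Γ*-resp : Γ* Respects _≋_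
  Γ*-resp {w} {v} e (g , ns) = Γ-resp e g , ns ∘ IsSingleton-resp {v} {w} (≋-sym {w} {v} e)

open Hypercoherence public

-- The hypercoherence with given web and strict atomic coherence.

fromStrict : (S : Setoid a a) (let open FiniteSubsets S) (G : List⁺ (Setoid.Carrier S) → Set a) →
             G Respects _≋_ → (∀ w → G w → ¬ IsSingleton w) → Hypercoherence a
fromStrict S G G-resp _ = record
  { web         = S
  ; Γ           = λ w → IsSingleton w ⊎ G w
  ; Γ-resp      = λ { {w} {v} e (inj₁ s) → inj₁ (IsSingleton-resp {w} {v} e s)
                    ; e (inj₂ g) → inj₂ (G-resp e g) }
  ; Γ-singleton = λ x → inj₁ ([x]-isSingleton x)
  }
  where open FiniteSubsets S

fromStrict-Γ* : (S : Setoid a a) (let open FiniteSubsets S) (G : List⁺ (Setoid.Carrier S) → Set a)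
                (r : G Respects _≋_) (n : ∀ w → G w → ¬ IsSingleton w) →
                ∀ w → Γ* (fromStrict S G r n) w ⇔ G w
fromStrict-Γ* S G r n w = mk⇔
  (λ { (inj₁ s , ns) → contradiction s ns ; (inj₂ g , _) → g })
  (λ g → inj₂ g , n w g)

infix 4 _≐_

-- Equality of hypercoherences: same web, same atomic coherence.

record _≐_ (X Y : Hypercoherence a) : Set (suc a) where
  field
    web-≡ : web X ≡ web Y
    Γ-⇔   : ∀ w → Γ X w ⇔ Γ Y (subst (List⁺ ∘ Setoid.Carrier) web-≡ w)

infix 25 _^⊥

_^⊥ : Hypercoherence a → Hypercoherence a
X ^⊥ = record
  { web         = web X
  ; Γ           = λ w → ¬ Γ* X w
  ; Γ-resp      = λ {w} {v} e ng g → ng (Γ*-resp X (≋-sym {w} {v} e) g)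
  ; Γ-singleton = λ x g → proj₂ g ([x]-isSingleton x)
  }
  where open FiniteSubsets (web X)

module _ (X Y : Hypercoherence a) where
  private
    module X = FiniteSubsets (web X)
    module Y = FiniteSubsets (web Y)

    X×Y : Setoid a a
    X×Y = ×-setoid (web X) (web Y)

    open FiniteSubsets X×Y using (_≋_; ≋-sym; IsSingleton)

    π₁ : List⁺ (∣ X ∣ × ∣ Y ∣) → List⁺ ∣ X ∣
    π₁ = map proj₁

    π₂ : List⁺ (∣ X ∣ × ∣ Y ∣) → List⁺ ∣ Y ∣
    π₂ = map proj₂

    π₁-≋ : ∀ {w v} → w ≋ v → π₁ w X.≋ π₁ v
    π₁-≋ {w} {v} = map-≋ {S = X×Y} {T = web X} proj₁ {w} {v}

    π₂-≋ : ∀ {w v} → w ≋ v → π₂ w Y.≋ π₂ v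
    π₂-≋ {w} {v} = map-≋ {S = X×Y} {T = web Y} proj₂ {w} {v}

  infixr 20 _⊸_
  infixr 20 _◁_

  _⊸_ : Hypercoherence a
  _⊸_ = record
    { web         = X×Y
    ; Γ           = Γ⊸
    ; Γ-resp      = λ {w} {v} e (p , q) →
        let e₁ = π₁-≋ {v} {w} (≋-sym {w} {v} e)
            e₂ = π₂-≋ {w} {v} e
        in (λ g → Γ-resp Y e₂ (p (Γ-resp X e₁ g)))
         , λ (g , t) →
             let (h , s) = q (Γ-resp X e₁ g , X.AtLeastTwo-resp {π₁ v} {π₁ w} e₁ t)
             in Γ-resp Y e₂ h , Y.AtLeastTwo-resp {π₂ w} {π₂ v} e₂ s
    ; Γ-singleton = λ (x , y) →
        (λ _ → Γ-singleton Y y)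
      , λ (_ , t) → contradiction t (X.¬AtLeastTwo-[x] {[ x ]} (X.[x]-isSingleton x))
    }
    where
    Γ⊸ : List⁺ (∣ X ∣ × ∣ Y ∣) → Set _
    Γ⊸ w = (Γ X (π₁ w) → Γ Y (π₂ w))
         × (Γ X (π₁ w) × X.AtLeastTwo (π₁ w) → Γ Y (π₂ w) × Y.AtLeastTwo (π₂ w))

  _◁_ : Hypercoherence a
  _◁_ = fromStrict X×Y Γ*◁ resp nonSingleton
    where
    Γ*◁ : List⁺ (∣ X ∣ × ∣ Y ∣) → Set _
    Γ*◁ w = Γ* X (π₁ w) ⊎ (X.IsSingleton (π₁ w) × Γ* Y (π₂ w))

    resp : Γ*◁ Respects _≋_
    resp {w} {v} e (inj₁ g)       = inj₁ (Γ*-resp X (π₁-≋ {w} {v} e) g)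
    resp {w} {v} e (inj₂ (s , g)) =
      inj₂ (X.IsSingleton-resp {π₁ w} {π₁ v} (π₁-≋ {w} {v} e) s , Γ*-resp Y (π₂-≋ {w} {v} e) g)

    nonSingleton : ∀ w → Γ*◁ w → ¬ IsSingleton w
    nonSingleton w (inj₁ (_ , ns)) s       = ns (map-isSingleton {S = X×Y} {T = web X} proj₁ {w} s)
    nonSingleton w (inj₂ (_ , _ , ns)) s   = ns (map-isSingleton {S = X×Y} {T = web Y} proj₂ {w} s)

infix 4 _⟶_

record _⟶_ (X Y : Hypercoherence a) : Set (suc a) where
  field
    rel      : Pred (∣ X ∣ × ∣ Y ∣) a
    rel-resp : rel Respects Setoid._≈_ (web (X ⊸ Y))
    linear   : ∀ w → All rel w → Γ (X ⊸ Y) w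

open _⟶_ public

infix 4 _≈ₗ_

_≈ₗ_ : {X Y : Hypercoherence a} → X ⟶ Y → X ⟶ Y → Set a
f ≈ₗ g = ∀ p → rel f p ⇔ rel g p

idₗ : {X : Hypercoherence a} → X ⟶ X
idₗ {X = X} = record
  { rel      = uncurry X._≈_
  ; rel-resp = λ (e₁ , e₂) e → X.trans (X.sym e₁) (X.trans e e₂)
  ; linear   = λ w d →
      let e = diag w d
      in Γ-resp X e
       , λ (g , t) → Γ-resp X e g , F.AtLeastTwo-resp {map proj₁ w} {map proj₂ w} e t
  }
  where
  module X = Setoid (web X)
  module F = FiniteSubsets (web X)
  open Subset (web X) using (_⊆_)

  to : ∀ {ps} → ListAll.All (uncurry X._≈_) ps → List.map proj₁ ps ⊆ List.map proj₂ ps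
  to (e ListAll.∷ _)  (here p)  = here (X.trans p e)
  to (_ ListAll.∷ es) (there m) = there (to es m)

  from : ∀ {ps} → ListAll.All (uncurry X._≈_) ps → List.map proj₂ ps ⊆ List.map proj₁ ps
  from (e ListAll.∷ _)  (here p)  = here (X.trans p (X.sym e))
  from (_ ListAll.∷ es) (there m) = there (from es m)

  diag : ∀ w → All (uncurry X._≈_) w → map proj₁ w F.≋ map proj₂ w
  diag (_ ∷ _) (e ∷ es) = to (e ListAll.∷ es) , from (e ListAll.∷ es)

infixr 9 _∘ₗ_

_∘ₗ_ : {X Y Z : Hypercoherence a} → Y ⟶ Z → X ⟶ Y → X ⟶ Z
_∘ₗ_ {X = X} {Y} {Z} g f = record
  { rel      = R
  ; rel-resp = λ (e₁ , e₂) (y , p , q) →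
      y , rel-resp f (e₁ , Setoid.refl (web Y)) p , rel-resp g (Setoid.refl (web Y) , e₂) q
  ; linear   = lin
  }
  where
  R : Pred (∣ X ∣ × ∣ Z ∣) _
  R (x , z) = ∃ λ y → rel f (x , y) × rel g (y , z)

  left : ∀ {ps} → ListAll.All R ps → List (∣ X ∣ × ∣ Y ∣)
  left ListAll.[] = []
  left {(x , _) ∷ _} ((y , _) ListAll.∷ rs) = (x , y) ∷ left rs

  right : ∀ {ps} → ListAll.All R ps → List (∣ Y ∣ × ∣ Z ∣)
  right ListAll.[] = []
  right {(_ , z) ∷ _} ((y , _) ListAll.∷ rs) = (y , z) ∷ right rs

  left-rel : ∀ {ps} (rs : ListAll.All R ps) → ListAll.All (rel f) (left rs)
  left-rel ListAll.[] = ListAll.[]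
  left-rel ((_ , p , _) ListAll.∷ rs) = p ListAll.∷ left-rel rs

  right-rel : ∀ {ps} (rs : ListAll.All R ps) → ListAll.All (rel g) (right rs)
  right-rel ListAll.[] = ListAll.[]
  right-rel ((_ , _ , q) ListAll.∷ rs) = q ListAll.∷ right-rel rs

  outer₁ : ∀ {ps} (rs : ListAll.All R ps) → List.map proj₁ (left rs) ≡ List.map proj₁ ps
  outer₁ ListAll.[] = refl
  outer₁ (_ ListAll.∷ rs) = cong (_ ∷_) (outer₁ rs)

  middle : ∀ {ps} (rs : ListAll.All R ps) → List.map proj₂ (left rs) ≡ List.map proj₁ (right rs)
  middle ListAll.[] = refl
  middle (_ ListAll.∷ rs) = cong (_ ∷_) (middle rs)

  outer₂ : ∀ {ps} (rs : ListAll.All R ps) → List.map proj₂ (right rs) ≡ List.map proj₂ ps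
  outer₂ ListAll.[] = refl
  outer₂ (_ ListAll.∷ rs) = cong (_ ∷_) (outer₂ rs)

  lin : ∀ w → All R w → Γ (X ⊸ Z) w
  lin ((x , z) ∷ ps) ((y , p , q) ∷ rs)
    with linear f ((x , y) ∷ left rs) (p ∷ left-rel rs)
       | linear g ((y , z) ∷ right rs) (q ∷ right-rel rs)
  ... | f₁ , f₂ | g₁ , g₂ rewrite outer₁ rs | middle rs | outer₂ rs =
    (λ h → g₁ (f₁ h)) , λ h → g₂ (f₂ h)

infix 4 _RetractOf_ _≅_

record _RetractOf_ (X Y : Hypercoherence a) : Set (suc a) where
  field
    section    : X ⟶ Y
    retraction : Y ⟶ X
    retract    : retraction ∘ₗ section ≈ₗ idₗ

record _≅_ (X Y : Hypercoherence a) : Set (suc a) where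
  field
    to      : X ⟶ Y
    from    : Y ⟶ X
    from∘to : from ∘ₗ to ≈ₗ idₗ
    to∘from : to ∘ₗ from ≈ₗ idₗ

-- Infinite words on {0,1}, with 0 = false and 1 = true, up to pointwise
-- equality _≗_.

2^ω : Set
2^ω = ℕ → Bool

infixr 5 _∷ω_ _++ω_

_∷ω_ : Bool → 2^ω → 2^ω
(b ∷ω u) zero   = b
(b ∷ω u) (1+ n) = u n

_++ω_ : List Bool → 2^ω → 2^ω
[]      ++ω u = u
(b ∷ m) ++ω u = b ∷ω (m ++ω u)

infix 4 _<ω_

_<ω_ : 2^ω → 2^ω → Set
u <ω v = ∃ λ m → ∃₂ λ u′ v′ → u ≗ m ++ω (false ∷ω u′) × v ≗ m ++ω (true ∷ω v′)

-- The product topology: U is open iff it contains, with each of its points u,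
-- the basic open set of all words sharing some finite prefix with u.

Open : Pred 2^ω a → Set a
Open U = ∀ u → U u → ∃ λ n → ∀ v → (∀ i → i < n → v i ≡ u i) → U v

module _ (S : Setoid a a) where
  open Setoid S renaming (Carrier to M; refl to ≈-refl; sym to ≈-sym; trans to ≈-trans)

  -- The singletons form a base of the discrete topology, so continuity is
  -- openness of their preimages.
  Continuous : (2^ω → M) → Set a
  Continuous f = ∀ x → Open (λ u → f u ≈ x)

  ContinuousMaps : Setoid a a
  ContinuousMaps = record
    { Carrier       = Σ (2^ω → M) Continuous
    ; _≈_           = λ (f , _) (g , _) → ∀ u → f u ≈ g u
    ; isEquivalence = record
      { refl  = λ _ → ≈-refl
      ; sym   = λ e u → ≈-sym (e u)
      ; trans = λ e e′ u → ≈-trans (e u) (e′ u)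
      }
    }

flag : Hypercoherence a → Hypercoherence a
flag X = fromStrict C Γ*flag resp nonSingleton
  where
  C = ContinuousMaps (web X)
  module F = FiniteSubsets C
  open FiniteSubsets (web X)

  infix 5 _at_

  _at_ : List⁺ (Setoid.Carrier C) → 2^ω → List⁺ ∣ X ∣
  w at u = map (λ f → proj₁ f u) w

  Γ*flag : List⁺ (Setoid.Carrier C) → Set _
  Γ*flag w = ∃ λ u → Γ* X (w at u) × (∀ u′ → u′ <ω u → IsSingleton (w at u′))

  at-≋ : ∀ {w v} u → w F.≋ v → w at u ≋ v at u
  at-≋ {w} {v} u = map-≋ {S = C} {T = web X} (λ e → e u) {w} {v}

  resp : Γ*flag Respects F._≋_
  resp {w} {v} e (u , g , below) =
    u , Γ*-resp X (at-≋ {w} {v} u e) g ,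
    λ u′ l → IsSingleton-resp {w at u′} {v at u′} (at-≋ {w} {v} u′ e) (below u′ l)

  nonSingleton : ∀ w → Γ*flag w → ¬ F.IsSingleton w
  nonSingleton w (u , (_ , ns) , _) s =
    ns (map-isSingleton {S = C} {T = web X} (λ e → e u) {w} s)

{-# OPTIONS --safe #-}

-- The set of words where finitely many continuous functions fail to agree is
-- clopen, so if it is nonempty it has a lexicographically least element, found
-- by greedily choosing bits.  Coherence in flag A is decided at that point
-- alone, which gives self-duality.  Constant functions embed A into flag A.
-- Finally, 2^ω is the ordered sum of its words starting with 0 and of those
-- starting with 1, so restricting a function to the two halves identifies
-- flag A with (flag A) ◁ (flag A).

module Submission where

open import Defs
open import Axiom.ExcludedMiddle using (ExcludedMiddle)
open import Axiom.DoubleNegationElimination using (em⇒dne)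
open import Data.Bool.Base using (Bool; true; false; if_then_else_)
import Data.Bool.Properties as Bool
open import Data.List.Base using ([]; _∷_)
import Data.List.Base as List
import Data.List.Membership.Setoid as Membership
open import Data.List.Membership.Setoid.Properties using (∈-map⁺; ∈-map⁻)
open import Data.List.NonEmpty.Base using (List⁺; _∷_; [_]; map; toList)
import Data.List.NonEmpty.Base as List⁺
open import Data.List.NonEmpty.Properties using (map-∘; map-id)
open import Data.List.NonEmpty.Relation.Unary.All using (All; _∷_)
import Data.List.Relation.Unary.All as ListAll
import Data.List.Relation.Unary.All.Properties as ListAll
open import Data.List.Relation.Binary.Pointwise using (Pointwise; []; _∷_)
import Data.List.Relation.Binary.Pointwise as Pointwise
open import Data.List.Relation.Binary.Subset.Setoid.Properties using (⊆-reflexive)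
open import Data.List.Relation.Unary.Any using (here; there)
open import Data.Nat.Base using (zero; suc; _<_; _⊔_; s≤s; z≤n; s<s⁻¹)
open import Data.Nat.Properties using (m<n⇒m<n⊔o; m<n⇒m<o⊔n; <-trans; n<1+n)
open import Data.Product.Base using (∃; _×_; _,_; proj₁; proj₂; uncurry)
open import Data.Sum.Base using (_⊎_; inj₁; inj₂)
import Data.Sum.Base as Sum
open import Function.Base using (_∘_)
open import Function.Bundles using (_⇔_; mk⇔; Equivalence)
open import Level using (Level; Lift; lift; lower)
open import Relation.Binary.Bundles using (Setoid)
open import Relation.Binary.Core using (_Preserves_⟶_)
open import Relation.Binary.Definitions using (_Respects_)
open import Relation.Binary.PropositionalEquality using (_≡_; _≢_; _≗_; refl; sym; trans; cong₂; subst)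
open import Relation.Nullary.Decidable using (Dec; yes; no)
open import Relation.Nullary.Negation using (¬_; contradiction)
open import Relation.Unary using (Pred)

private
  variable
    a : Level

-- Finite subsets

module _ (S : Setoid a a) where
  open Setoid S renaming (Carrier to M; refl to ≈-refl; sym to ≈-sym; trans to ≈-trans)
  open FiniteSubsets S
  open Membership S using (_∈_)

  pointwise⇒≋ : ∀ {w v} → Pointwise _≈_ (toList w) (toList v) → w ≋ v
  pointwise⇒≋ ps = ⊆-reflexive S ps , ⊆-reflexive S (Pointwise.symmetric ≈-sym ps)

  map-cong-≋ : {B : Set a} {f g : B → M} → (∀ x → f x ≈ g x) → ∀ w → map f w ≋ map g w
  map-cong-≋ {f = f} {g} f≈g (x ∷ xs) = pointwise⇒≋ {map f (x ∷ xs)} {map g (x ∷ xs)} (go (x ∷ xs))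
    where
    go : ∀ ys → Pointwise _≈_ (List.map f ys) (List.map g ys)
    go []       = []
    go (y ∷ ys) = f≈g y ∷ go ys

  isSingleton⇒≈ : ∀ {w x y} → IsSingleton w → x ∈ toList w → y ∈ toList w → x ≈ y
  isSingleton⇒≈ (z , w⊆[z] , _) x∈w y∈w with w⊆[z] x∈w | w⊆[z] y∈w
  ... | here x≈z | here y≈z = ≈-trans x≈z (≈-sym y≈z)

  -- Comparison with the head turns being a singleton into finitely many equations, the form used
  -- for openness later.
  ≈head⇒isSingleton : ∀ w → (∀ {x} → x ∈ toList w → x ≈ List⁺.head w) → IsSingleton w
  ≈head⇒isSingleton (x ∷ xs) ≈x = x , (λ m → here (≈x m)) , λ { (here y≈x) → here y≈x }

module _ {S T : Setoid a a} where
  private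
    module S = Setoid S
    module T = Setoid T
    module FS = FiniteSubsets S
    module FT = FiniteSubsets T

  module _ {f : S.Carrier → T.Carrier} (injective : ∀ {x y} → f x T.≈ f y → x S.≈ y)
           (cong-f : f Preserves S._≈_ ⟶ T._≈_) where

    map-isSingleton⁻ : ∀ {w} → FT.IsSingleton (map f w) → FS.IsSingleton w
    map-isSingleton⁻ {x ∷ xs} s = ≈head⇒isSingleton S (x ∷ xs) λ y∈w →
      injective (isSingleton⇒≈ T {map f (x ∷ xs)} s (∈-map⁺ S T cong-f y∈w) (here T.refl))

    map-atLeastTwo⁺ : ∀ {w} → FS.AtLeastTwo w → FT.AtLeastTwo (map f w)
    map-atLeastTwo⁺ (x , y , x∈w , y∈w , x≉y) =
      f x , f y , ∈-map⁺ S T cong-f x∈w , ∈-map⁺ S T cong-f y∈w , x≉y ∘ injective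

  map-atLeastTwo⁻ : ∀ {f : S.Carrier → T.Carrier} → f Preserves S._≈_ ⟶ T._≈_ →
                    ∀ {w} → FT.AtLeastTwo (map f w) → FS.AtLeastTwo w
  map-atLeastTwo⁻ cong-f (_ , _ , fx∈ , fy∈ , fx≉fy) with ∈-map⁻ S T fx∈ | ∈-map⁻ S T fy∈
  ... | x , x∈w , ≈fx | y , y∈w , ≈fy =
    x , y , x∈w , y∈w , λ x≈y → fx≉fy (T.trans ≈fx (T.trans (cong-f x≈y) (T.sym ≈fy)))

-- Embeddings of hypercoherences

record Embedding (X Y : Hypercoherence a) : Set a where
  private
    module X = Setoid (web X)
    module Y = Setoid (web Y)

  field
    emb       : ∣ X ∣ → ∣ Y ∣
    emb-cong  : emb Preserves X._≈_ ⟶ Y._≈_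
    injective : ∀ {x y} → emb x Y.≈ emb y → x X.≈ y
    Γ-emb     : ∀ w → Γ X w ⇔ Γ Y (map emb w)

module _ {X Y : Hypercoherence a} (E : Embedding X Y) where
  open Embedding E
  private
    module X = Setoid (web X)
    module Y = Setoid (web Y)
    module FX = FiniteSubsets (web X)
    module FY = FiniteSubsets (web Y)

    images : ∀ {ps} → ListAll.All (λ (x , y) → emb x Y.≈ y) ps →
             Pointwise Y._≈_ (List.map emb (List.map proj₁ ps)) (List.map proj₂ ps)
    images ListAll.[]       = []
    images (e ListAll.∷ es) = e ∷ images es

    images′ : ∀ {ps} → ListAll.All (λ (y , x) → emb x Y.≈ y) ps →
              Pointwise Y._≈_ (List.map emb (List.map proj₂ ps)) (List.map proj₁ ps)
    images′ ListAll.[]       = []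
    images′ (e ListAll.∷ es) = e ∷ images′ es

  -- For a finite part of the graph, the second projection is the image of the first. Preservation
  -- of `Γ` carries coherence over, and injectivity keeps two distinct elements distinct.
  graph : X ⟶ Y
  graph = record
    { rel      = λ (x , y) → emb x Y.≈ y
    ; rel-resp = λ (x≈x′ , y≈y′) e → Y.trans (emb-cong (X.sym x≈x′)) (Y.trans e y≈y′)
    ; linear   = lin
    }
    where
    lin : ∀ w → All (λ (x , y) → emb x Y.≈ y) w → Γ (X ⊸ Y) w
    lin w@(_ ∷ _) (e ∷ es) = Γ-to , λ (g , t) → Γ-to g ,
      FY.AtLeastTwo-resp {map emb (map proj₁ w)} {map proj₂ w} w₁≋w₂
        (map-atLeastTwo⁺ {S = web X} {T = web Y} injective emb-cong {map proj₁ w} t)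
      where
      w₁≋w₂ = pointwise⇒≋ (web Y) {map emb (map proj₁ w)} {map proj₂ w} (images (e ListAll.∷ es))
      Γ-to : Γ X (map proj₁ w) → Γ Y (map proj₂ w)
      Γ-to g = Γ-resp Y w₁≋w₂ (Equivalence.to (Γ-emb (map proj₁ w)) g)

  -- Now the first projection is the image of the second, so the argument uses reflection of `Γ`.
  -- Distinct images have distinct preimages because `emb` respects equality.
  cograph : Y ⟶ X
  cograph = record
    { rel      = λ (y , x) → emb x Y.≈ y
    ; rel-resp = λ (y≈y′ , x≈x′) e → Y.trans (emb-cong (X.sym x≈x′)) (Y.trans e y≈y′)
    ; linear   = lin
    }
    where
    lin : ∀ w → All (λ (y , x) → emb x Y.≈ y) w → Γ (Y ⊸ X) w
    lin w@(_ ∷ _) (e ∷ es) = Γ-to , λ (g , t) → Γ-to g ,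
      map-atLeastTwo⁻ {S = web X} {T = web Y} emb-cong {map proj₂ w}
        (FY.AtLeastTwo-resp {map proj₁ w} {map emb (map proj₂ w)} w₁≋w₂ t)
      where
      w₁≋w₂ = FY.≋-sym {map emb (map proj₂ w)} {map proj₁ w}
        (pointwise⇒≋ (web Y) {map emb (map proj₂ w)} {map proj₁ w} (images′ (e ListAll.∷ es)))
      Γ-to : Γ Y (map proj₁ w) → Γ X (map proj₂ w)
      Γ-to g = Equivalence.from (Γ-emb (map proj₂ w)) (Γ-resp Y w₁≋w₂ g)

  cograph∘graph : cograph ∘ₗ graph ≈ₗ idₗ
  cograph∘graph (x , x′) = mk⇔
    (λ (y , e , e′) → injective (Y.trans e (Y.sym e′)))
    (λ x≈x′ → emb x , Y.refl , emb-cong (X.sym x≈x′))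

  embedding⇒retract : X RetractOf Y
  embedding⇒retract = record { section = graph ; retraction = cograph ; retract = cograph∘graph }

  -- In the composite on `Y`, two elements are related when both are the image of one `x`;
  -- surjectivity supplies such an `x` at each point of the diagonal.
  surjective⇒≅ : (∀ y → ∃ λ x → emb x Y.≈ y) → X ≅ Y
  surjective⇒≅ surjective = record
    { to      = graph
    ; from    = cograph
    ; from∘to = cograph∘graph
    ; to∘from = λ (y , y′) → mk⇔
        (λ (x , e , e′) → Y.trans (Y.sym e) e′)
        (λ y≈y′ → let (x , e) = surjective y in x , e , Y.trans e y≈y′)
    }

-- Lexicographic order on infinite words

tailω : 2^ω → 2^ω
tailω u n = u (suc n)

∷ω-cong : ∀ b {u v} → u ≗ v → b ∷ω u ≗ b ∷ω v
∷ω-cong b e zero    = refl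
∷ω-cong b e (suc n) = e n

∷ω-η : ∀ {b} u → u 0 ≡ b → b ∷ω tailω u ≗ u
∷ω-η u e zero    = sym e
∷ω-η u e (suc n) = refl

<ω-resp : ∀ {u u′ v v′} → u ≗ u′ → v ≗ v′ → u <ω v → u′ <ω v′
<ω-resp eu ev (m , x , y , p , q) =
  m , x , y , (λ n → trans (sym (eu n)) (p n)) , λ n → trans (sym (ev n)) (q n)

0∷<1∷ : ∀ u v → (false ∷ω u) <ω (true ∷ω v)
0∷<1∷ u v = [] , u , v , (λ _ → refl) , λ _ → refl

∷ω-mono-< : ∀ b {u v} → u <ω v → (b ∷ω u) <ω (b ∷ω v)
∷ω-mono-< b (m , x , y , p , q) = b ∷ m , x , y , ∷ω-cong b p , ∷ω-cong b q

-- The branching prefix is either nonempty, and then the heads agree and the tails are compared, or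
-- empty, and then the first bit decides.
<ω-∷ω⁻ : ∀ b {u v} → u <ω (b ∷ω v) → (u 0 ≡ b × tailω u <ω v) ⊎ (u 0 ≡ false × b ≡ true)
<ω-∷ω⁻ b ([]    , x , y , p , q) = inj₂ (p 0 , q 0)
<ω-∷ω⁻ b (_ ∷ m , x , y , p , q) =
  inj₁ (trans (p 0) (sym (q 0)) , m , x , y , p ∘ suc , q ∘ suc)

-- Induction on the position of a known disagreement: distinct first bits decide the order at once,
-- equal ones are stripped. This reaches the first disagreement at or before `n`.
≢⇒<ω⊎>ω : ∀ n u v → u n ≢ v n → u <ω v ⊎ v <ω u
≢⇒<ω⊎>ω n u v ≢ with u 0 in eu | v 0 in ev
... | false | true  = inj₁ (<ω-resp (∷ω-η u eu) (∷ω-η v ev) (0∷<1∷ _ _))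
... | true  | false = inj₂ (<ω-resp (∷ω-η v ev) (∷ω-η u eu) (0∷<1∷ _ _))
≢⇒<ω⊎>ω zero u v ≢ | false | false = contradiction (trans eu (sym ev)) ≢
≢⇒<ω⊎>ω zero u v ≢ | true  | true  = contradiction (trans eu (sym ev)) ≢
≢⇒<ω⊎>ω (suc n) u v ≢ | false | false = Sum.map
  (<ω-resp (∷ω-η u eu) (∷ω-η v ev) ∘ ∷ω-mono-< false)
  (<ω-resp (∷ω-η v ev) (∷ω-η u eu) ∘ ∷ω-mono-< false) (≢⇒<ω⊎>ω n (tailω u) (tailω v) ≢)
≢⇒<ω⊎>ω (suc n) u v ≢ | true | true = Sum.map
  (<ω-resp (∷ω-η u eu) (∷ω-η v ev) ∘ ∷ω-mono-< true)
  (<ω-resp (∷ω-η v ev) (∷ω-η u eu) ∘ ∷ω-mono-< true) (≢⇒<ω⊎>ω n (tailω u) (tailω v) ≢)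

-- Statements about words live at level zero, whereas excluded middle is assumed at the level of the
-- web.
em-zero : ExcludedMiddle a → (P : Set) → Dec P
em-zero {a} em P with em {P = Lift a P}
... | yes p = yes (lower p)
... | no ¬p = no (¬p ∘ lift)

<ω-compare : ExcludedMiddle a → ∀ u v → u ≗ v ⊎ u <ω v ⊎ v <ω u
<ω-compare em u v with em-zero em (∃ λ n → u n ≢ v n)
... | yes (n , ≢) = inj₂ (≢⇒<ω⊎>ω n u v ≢)
... | no ¬∃       = inj₁ eq
  where
  eq : u ≗ v
  eq n with u n Bool.≟ v n
  ... | yes e = e
  ... | no ≢  = contradiction (n , ≢) ¬∃

-- Open sets

Open⇒Respects : {U : Pred 2^ω a} → Open U → U Respects _≗_
Open⇒Respects U-open {u} {v} u≗v Uu = proj₂ (U-open u Uu) v (λ i _ → sym (u≗v i))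

Open-∩ : {U V : Pred 2^ω a} → Open U → Open V → Open (λ u → U u × V u)
Open-∩ U-open V-open u (Uu , Vu) with U-open u Uu | V-open u Vu
... | m , inU | n , inV = m ⊔ n , λ v agree →
  inU v (λ i i<m → agree i (m<n⇒m<n⊔o n i<m)) , inV v (λ i i<n → agree i (m<n⇒m<o⊔n m i<n))

Open-All : {B : Set a} {U : B → Pred 2^ω a} → (∀ x → Open (U x)) →
           ∀ xs → Open (λ u → ListAll.All (λ x → U x u) xs)
Open-All U-open []       u _ = 0 , λ _ _ → ListAll.[]
Open-All U-open (x ∷ xs) u (p ListAll.∷ ps)
  with Open-∩ (U-open x) (Open-All U-open xs) u (p , ps)
... | n , h = n , λ v agree → let (q , qs) = h v agree in q ListAll.∷ qs

-- Least words outside an open set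

module _ (em : ExcludedMiddle a) where

  private
    bit : Pred 2^ω a → Bool
    bit Q with em {P = ∃ λ v → Q (false ∷ω v)}
    ... | yes _ = false
    ... | no  _ = true

    after : Pred 2^ω a → Pred 2^ω a
    after Q v = Q (bit Q ∷ω v)

    -- Each bit is 0 whenever some word of the current predicate starts with 0. The limit word need
    -- not satisfy `Q` in general; it does when `Q` is closed, as in `leastOutside`.
    greedy : Pred 2^ω a → 2^ω
    greedy Q zero    = bit Q
    greedy Q (suc n) = greedy (after Q) n

    after-resp : ∀ {Q} → Q Respects _≗_ → after Q Respects _≗_
    after-resp resp e = resp (∷ω-cong _ e)

    after-inhabited : ∀ {Q} → Q Respects _≗_ → ∃ Q → ∃ (after Q)
    after-inhabited {Q} resp (u , Qu) with em {P = ∃ λ v → Q (false ∷ω v)}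
    ... | yes ∃v = ∃v
    ... | no ¬∃v with u 0 in eq
    ...   | false = contradiction (tailω u , resp (sym ∘ ∷ω-η u eq) Qu) ¬∃v
    ...   | true  = tailω u , resp (sym ∘ ∷ω-η u eq) Qu

    -- Every chosen bit leaves an inhabited predicate on the tails, so each finite prefix of the
    -- greedy word extends to a member of `Q`.
    greedy-near : ∀ n {Q} → Q Respects _≗_ → ∃ Q →
                  ∃ λ v → Q v × (∀ i → i < n → v i ≡ greedy Q i)
    greedy-near zero    resp (u , Qu) = u , Qu , λ _ ()
    greedy-near (suc n) {Q} resp ∃Q
      with greedy-near n {after Q} (after-resp {Q} resp) (after-inhabited resp ∃Q)
    ... | v , Qv , agree = bit Q ∷ω v , Qv ,
      λ { zero _ → refl ; (suc i) i<n → agree i (s<s⁻¹ i<n) }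

    bit-least : ∀ {Q v} → Q (false ∷ω v) → bit Q ≡ false
    bit-least {Q} {v} Qv with em {P = ∃ λ v → Q (false ∷ω v)}
    ... | yes _  = refl
    ... | no ¬∃v = contradiction (v , Qv) ¬∃v

    -- Where `u` branches off below, it has a 0 and the greedy word a 1; but 1 is chosen only when
    -- no member continues with 0. The induction strips the common prefix.
    greedy-least : ∀ m {u′ v′ u Q} → Q Respects _≗_ → u ≗ m ++ω (false ∷ω u′) →
                   greedy Q ≗ m ++ω (true ∷ω v′) → ¬ Q u
    greedy-least [] {u = u} {Q} resp p q Qu
      with trans (sym (bit-least {Q} (resp (sym ∘ ∷ω-η u (p 0)) Qu))) (q 0)
    ... | ()
    greedy-least (b ∷ m) {u = u} {Q} resp p q Qu =
      greedy-least m {u = tailω u} {after Q} (after-resp {Q} resp) (p ∘ suc) (q ∘ suc)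
        (resp (sym ∘ ∷ω-η u (trans (p 0) (sym (q 0)))) Qu)

  -- If the greedy word of the complement were in `U`, so would be every word sharing a long enough
  -- prefix with it, contradicting `greedy-near`. Minimality is `greedy-least`, up to a double
  -- negation.
  leastOutside : {U : Pred 2^ω a} → Open U → (∃ λ u → ¬ U u) →
                 ∃ λ u → ¬ U u × (∀ u′ → u′ <ω u → U u′)
  leastOutside {U} U-open ∃¬U = greedy ¬U , outside , λ u′ (m , _ , _ , p , q) →
      em⇒dne em (greedy-least m {Q = ¬U} ¬U-resp p q)
    where
    ¬U : Pred 2^ω a
    ¬U u = ¬ U u

    ¬U-resp : ¬U Respects _≗_
    ¬U-resp e ¬Uu Uv = ¬Uu (Open⇒Respects U-open (sym ∘ e) Uv)

    outside : ¬ U (greedy ¬U)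
    outside Ug with U-open (greedy ¬U) Ug
    ... | n , near with greedy-near n {¬U} ¬U-resp ∃¬U
    ...   | v , ¬Uv , agree = ¬Uv (near v agree)

-- Continuous maps

module Evaluation (S : Setoid a a) where
  open Setoid S renaming (Carrier to M; refl to ≈-refl; sym to ≈-sym; trans to ≈-trans)
  private
    C = ContinuousMaps S
    module C = Setoid C
    module FC = FiniteSubsets C
  open FiniteSubsets S

  eval : 2^ω → C.Carrier → M
  eval u f = proj₁ f u

  infix 5 _at_

  _at_ : List⁺ C.Carrier → 2^ω → List⁺ M
  w at u = map (eval u) w

  -- The preimage of the value at `u` is open, and an open set cannot separate pointwise equal
  -- words.
  continuous⇒resp : (f : C.Carrier) → ∀ {u v} → u ≗ v → eval u f ≈ eval v f
  continuous⇒resp (f , cont) {u} {v} e = ≈-sym (Open⇒Respects (cont (f u)) e ≈-refl)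

  at-≗ : ∀ w {u v} → u ≗ v → w at u ≋ w at v
  at-≗ w e = map-cong-≋ S (λ f → continuous⇒resp f e) w

  -- Near a point of agreement both maps keep the common value, since both are locally constant.
  Open-equalizer : (f g : C.Carrier) → Open (λ u → eval u f ≈ eval u g)
  Open-equalizer (f , f-cont) (g , g-cont) u fu≈gu
    with Open-∩ (f-cont (g u)) (g-cont (g u)) u (fu≈gu , ≈-refl)
  ... | n , h = n , λ v agree → let (p , q) = h v agree in ≈-trans p (≈-sym q)

  isSingleton-at⇒ : ∀ f fs {u} → IsSingleton ((f ∷ fs) at u) →
                    ListAll.All (λ g → eval u g ≈ eval u f) fs
  isSingleton-at⇒ f fs {u} s = ListAll.map⁻ (ListAll.tabulateₛ S λ x∈ →
    isSingleton⇒≈ S {(f ∷ fs) at u} s (there x∈) (here ≈-refl))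

  isSingleton-at⇐ : ∀ f fs {u} → ListAll.All (λ g → eval u g ≈ eval u f) fs →
                    IsSingleton ((f ∷ fs) at u)
  isSingleton-at⇐ f fs {u} es = ≈head⇒isSingleton S ((f ∷ fs) at u) λ
    { (here e)  → e
    ; (there m) → ListAll.lookupₛ S (λ x≈y e → ≈-trans (≈-sym x≈y) e) (ListAll.map⁺ es) m }

  Open-isSingleton : ∀ w → Open (λ u → IsSingleton (w at u))
  Open-isSingleton (f ∷ fs) u s
    with Open-All (λ g → Open-equalizer g f) fs u (isSingleton-at⇒ f fs s)
  ... | n , h = n , λ v agree → isSingleton-at⇐ f fs (h v agree)

  isSingleton-pointwise : ∀ w → (∀ u → IsSingleton (w at u)) → FC.IsSingleton w
  isSingleton-pointwise w@(f ∷ fs) s = ≈head⇒isSingleton C w λ {g} g∈w u →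
    isSingleton⇒≈ S {w at u} (s u) (∈-map⁺ C S {f = eval u} (λ e → e u) {g} g∈w) (here ≈-refl)

  constant : M → C.Carrier
  constant x = (λ _ → x) , λ y u e → 0 , λ _ _ → e

  restrict : Bool → C.Carrier → C.Carrier
  restrict b (f , cont) = (λ u → f (b ∷ω u)) , λ x u e → let (n , h) = cont x (b ∷ω u) e in
    n , λ v agree → h (b ∷ω v) λ { zero _ → refl ; (suc i) i<n → agree i (<-trans (n<1+n i) i<n) }

  glue : C.Carrier → C.Carrier → C.Carrier
  glue (f , f-cont) (g , g-cont) = h , cont
    where
    h : 2^ω → M
    h u = if u 0 then g (tailω u) else f (tailω u)

    cont : Continuous S h
    cont x u e with u 0 in eq
    -- One bit more than `n`: bit 0 fixes the half, and the next `n` bits control the map on that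
    -- half.
    ... | true  = let (n , near) = g-cont x (tailω u) e in suc n , λ v agree →
      subst (λ b → (if b then g (tailω v) else f (tailω v)) ≈ x)
        (sym (trans (agree 0 (s≤s z≤n)) eq)) (near (tailω v) λ i i<n → agree (suc i) (s≤s i<n))
    ... | false = let (n , near) = f-cont x (tailω u) e in suc n , λ v agree →
      subst (λ b → (if b then g (tailω v) else f (tailω v)) ≈ x)
        (sym (trans (agree 0 (s≤s z≤n)) eq)) (near (tailω v) λ i i<n → agree (suc i) (s≤s i<n))

-- Flag

module _ (X : Hypercoherence a) where
  open FiniteSubsets (web X)
  open Evaluation (web X)
  private
    S = web X
    C = ContinuousMaps S
    module FC = FiniteSubsets C

  Γ*flag : List⁺ (Setoid.Carrier C) → Set a
  Γ*flag w = ∃ λ u → Γ* X (w at u) × (∀ u′ → u′ <ω u → IsSingleton (w at u′))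

  Γ*-flag⇒ : ∀ {w} → Γ* (flag X) w → Γ*flag w
  Γ*-flag⇒ (inj₁ s , ns) = contradiction s ns
  Γ*-flag⇒ (inj₂ g , _)  = g

  Γ*-flag⇐ : ∀ {w} → Γ*flag w → Γ* (flag X) w
  Γ*-flag⇐ {w} g@(u , (_ , ns) , _) =
    inj₂ g , λ s → ns (map-isSingleton {S = C} {T = S} (λ e → e u) {w} s)

  -- The words at which all members agree form an open set. Either it is everything, and the members
  -- are equal as maps, or its complement has a least word.
  leastNonSingleton : ExcludedMiddle a → ∀ w → FC.IsSingleton w ⊎
    (∃ λ u → ¬ IsSingleton (w at u) × (∀ u′ → u′ <ω u → IsSingleton (w at u′)))
  leastNonSingleton em w with em {P = ∃ λ u → ¬ IsSingleton (w at u)}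
  ... | yes ∃u = inj₂ (leastOutside em (Open-isSingleton w) ∃u)
  ... | no ¬∃u = inj₁ (isSingleton-pointwise w λ u → em⇒dne em λ ns → ¬∃u (u , ns))

-- Self-duality of flag

flag-selfDual : ExcludedMiddle a → (A : Hypercoherence a) → (flag A) ^⊥ ≐ flag (A ^⊥)
flag-selfDual em A = record { web-≡ = refl ; Γ-⇔ = λ w → mk⇔ (to w) (from w) }
  where
  open Evaluation (web A)

  to : ∀ w → ¬ Γ* (flag A) w → Γ (flag (A ^⊥)) w
  to w ng with leastNonSingleton A em w
  ... | inj₁ s                = inj₁ s
  ... | inj₂ (u , ns , below) =
    -- Strict coherence of the values at `u` would make `w` strictly coherent in `flag A`, with `u`
    -- as witness.
    inj₂ (u , ((λ g → ng (Γ*-flag⇐ A (u , g , below))) , ns) , below)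

  from : ∀ w → Γ (flag (A ^⊥)) w → ¬ Γ* (flag A) w
  from w (inj₁ s) (_ , ns) = ns s
  from w (inj₂ (u , (ng , ns) , below)) g with Γ*-flag⇒ A {w} g
  ... | v , h , below′ with <ω-compare em u v
  -- The members disagree at `u` and at `v`, and agree strictly below each. Neither word can precede
  -- the other, so they coincide, and the values there would be both strictly coherent and not.
  ...   | inj₁ u≗v        = ng (Γ*-resp A (at-≗ w (sym ∘ u≗v)) h)
  ...   | inj₂ (inj₁ u<v) = ns (below′ u u<v)
  ...   | inj₂ (inj₂ v<u) = proj₂ h (below v v<u)

-- A as a retract of flag A

constant-embedding : ExcludedMiddle a → (A : Hypercoherence a) → Embedding A (flag A)
constant-embedding em A = record
  { emb       = constant
  ; emb-cong  = λ e _ → e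
  ; injective = λ e → e zeros
  ; Γ-emb     = λ w → mk⇔ (to w) (from w)
  }
  where
  S = web A
  C = ContinuousMaps S
  open FiniteSubsets S
  open Evaluation S

  zeros : 2^ω
  zeros _ = false

  -- The larger of two words has a 1 at the branching position.
  zeros-least : ∀ u → ¬ u <ω zeros
  zeros-least u (m , _ , _ , _ , q) = absurd m q
    where
    absurd : ∀ m {v} → ¬ zeros ≗ m ++ω (true ∷ω v)
    absurd []      e with e 0
    ... | ()
    absurd (_ ∷ m) e = absurd m (e ∘ suc)

  at-constant : ∀ w u → w ≋ map constant w at u
  at-constant w u = subst (w ≋_) (trans (sym (map-id w)) (map-∘ w)) ((λ m → m) , (λ m → m))

  to : ∀ w → Γ A w → Γ (flag A) (map constant w)
  to w g with em {P = IsSingleton w}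
  ... | yes s = inj₁ (map-isSingleton {S = S} {T = C} (λ e _ → e) {w} s)
  -- At the least word the requirement on smaller words is vacuous.
  ... | no ns = inj₂ (zeros , Γ*-resp A (at-constant w zeros) (g , ns) ,
    λ u u<0 → contradiction u<0 (zeros-least u))

  from : ∀ w → Γ (flag A) (map constant w) → Γ A w
  from w (inj₁ s) with map-isSingleton⁻ {S = S} {T = C} (λ e → e zeros) (λ e _ → e) {w} s
  ... | x , e = Γ-resp A (≋-sym {w} {[ x ]} e) (Γ-singleton A x)
  from w (inj₂ (u , g , _)) = proj₁ (Γ*-resp A (≋-sym {w} (at-constant w u)) g)

-- The isomorphism of flag A with flag A before itself

module _ (A : Hypercoherence a) where
  open FiniteSubsets (web A)
  open Evaluation (web A)
  private
    S = web A
    C = ContinuousMaps S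
    F = flag A
    module C = Setoid C
    module FC = FiniteSubsets C
    module A = Setoid S

    halves : C.Carrier → C.Carrier × C.Carrier
    halves f = restrict false f , restrict true f

    halves-injective : ∀ {f g} → restrict false f C.≈ restrict false g →
                       restrict true f C.≈ restrict true g → f C.≈ g
    halves-injective {f} {g} e₀ e₁ u with u 0 in eq
    ... | false = A.trans (continuous⇒resp f (sym ∘ ∷ω-η u eq))
                    (A.trans (e₀ (tailω u)) (continuous⇒resp g (∷ω-η u eq)))
    ... | true  = A.trans (continuous⇒resp f (sym ∘ ∷ω-η u eq))
                    (A.trans (e₁ (tailω u)) (continuous⇒resp g (∷ω-η u eq)))

    half : Bool → List⁺ C.Carrier → List⁺ C.Carrier
    half b = map (restrict b)

    half-at : ∀ b w u → u 0 ≡ b → w at u ≋ half b w at (tailω u)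
    half-at b w u eq = subst (w at u ≋_) (map-∘ w) (at-≗ w (sym ∘ ∷ω-η u eq))

    -- The witness moves to its tail: a word below `tailω u`, prefixed with `b`, lies below `u`.
    Γ*-half⁺ : ∀ b w u → u 0 ≡ b → Γ* A (w at u) →
               (∀ u′ → u′ <ω u → IsSingleton (w at u′)) → Γ*flag A (half b w)
    Γ*-half⁺ b w u eq g below = tailω u , Γ*-resp A (half-at b w u eq) g , λ v v<u →
      IsSingleton-resp {w at (b ∷ω v)} {half b w at v} (half-at b w (b ∷ω v) refl)
        (below (b ∷ω v) (<ω-resp (λ _ → refl) (∷ω-η u eq) (∷ω-mono-< b v<u)))

    isSingleton-half⁻ : ∀ b w u → u 0 ≡ b → IsSingleton (half b w at (tailω u)) →
                        IsSingleton (w at u)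
    isSingleton-half⁻ b w u eq = IsSingleton-resp {half b w at (tailω u)} {w at u}
      (≋-sym {w at u} (half-at b w u eq))

    -- A word below `b ∷ω u` either starts with `b` and has its tail below `u`, or starts with 0
    -- while `b` is 1. The hypothesis on `half false w` covers the second case.
    Γ*-half⁻ : ∀ b w → (b ≡ true → FC.IsSingleton (half false w)) →
               Γ*flag A (half b w) → Γ*flag A w
    Γ*-half⁻ b w s (u , g , below) = b ∷ω u ,
      Γ*-resp A (≋-sym {w at (b ∷ω u)} (half-at b w (b ∷ω u) refl)) g , below′
      where
      below′ : ∀ v → v <ω (b ∷ω u) → IsSingleton (w at v)
      below′ v v<bu with <ω-∷ω⁻ b v<bu
      ... | inj₁ (eq , tv<u) = isSingleton-half⁻ b w v eq (below (tailω v) tv<u)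
      ... | inj₂ (eq , b≡1)  = isSingleton-half⁻ false w v eq
        (map-isSingleton {S = C} {T = S} (λ e → e (tailω v)) {half false w} (s b≡1))

    Before : List⁺ C.Carrier → List⁺ C.Carrier → Set a
    Before w₁ w₂ = Γ* F w₁ ⊎ (FC.IsSingleton w₁ × Γ* F w₂)

    to : ∀ w → Γ*flag A w → Before (half false w) (half true w)
    to w (u , g , below) with u 0 in eq
    ... | false = inj₁ (Γ*-flag⇐ A (Γ*-half⁺ false w u eq g below))
    -- All words starting with 0 lie below `u`, so the members agree on the whole first half.
    ... | true  = inj₂
      ( isSingleton-pointwise (half false w) (λ v →
          IsSingleton-resp {w at (false ∷ω v)} {half false w at v}
            (half-at false w (false ∷ω v) refl)
            (below (false ∷ω v) (<ω-resp (λ _ → refl) (∷ω-η u eq) (0∷<1∷ v (tailω u)))))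
      , Γ*-flag⇐ A (Γ*-half⁺ true w u eq g below) )

    from : ∀ w → Before (half false w) (half true w) → Γ*flag A w
    from w (inj₁ g)       = Γ*-half⁻ false w (λ ()) (Γ*-flag⇒ A g)
    from w (inj₂ (s , g)) = Γ*-half⁻ true w (λ _ → s) (Γ*-flag⇒ A g)

  halves-embedding : Embedding (flag A) ((flag A) ◁ (flag A))
  halves-embedding = record
    { emb       = halves
    ; emb-cong  = λ {f} {g} → halves-cong {f} {g}
    ; injective = λ {f} {g} (e₀ , e₁) → halves-injective {f} {g} e₀ e₁
    ; Γ-emb     = λ w → mk⇔
        (λ { (inj₁ s) → inj₁ (map-isSingleton {S = C} {T = web (F ◁ F)}
               (λ {f} {g} → halves-cong {f} {g}) {w} s)
           ; (inj₂ g) → inj₂ (subst (uncurry Before) (projections-≡ w) (to w g)) })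
        (λ { (inj₁ s) → inj₁ (map-isSingleton⁻ {S = C} {T = web (F ◁ F)}
               (λ {f} {g} (e₀ , e₁) → halves-injective {f} {g} e₀ e₁)
               (λ {f} {g} → halves-cong {f} {g}) {w} s)
           ; (inj₂ g) → inj₂ (from w (subst (uncurry Before) (sym (projections-≡ w)) g)) })
    }
    where
    halves-cong : ∀ {f g} → f C.≈ g → Setoid._≈_ (web (F ◁ F)) (halves f) (halves g)
    halves-cong e = (λ u → e (false ∷ω u)) , (λ u → e (true ∷ω u))

    projections-≡ : ∀ w → (half false w , half true w) ≡
                          (map proj₁ (map halves w) , map proj₂ (map halves w))
    projections-≡ w = cong₂ _,_ (map-∘ w) (map-∘ w)

  -- Once the first bit is fixed, `glue f g` computes to `f` or to `g`.
  halves-surjective : ∀ p → ∃ λ f → Setoid._≈_ (web (F ◁ F)) (halves f) p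
  halves-surjective (f , g) = glue f g , (λ _ → A.refl) , (λ _ → A.refl)

proposition24 : {a : Level} → ExcludedMiddle a → (A : Hypercoherence a) →
    ((flag A) ^⊥ ≐ flag (A ^⊥)) × (A RetractOf flag A) × (flag A ≅ (flag A) ◁ (flag A))
proposition24 em A =
    flag-selfDual em A
  , embedding⇒retract (constant-embedding em A)
  , surjective⇒≅ (halves-embedding A) (halves-surjective A)
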